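{- Let $(Q,C,D)$ be an instance of the bilinear assignment problem. For local search based on the dual shift neighborhood, and likewise for local search based on the optimized shift neighborhood, started from any feasible solution, the final solution $(\mathbf{x},\mathbf{y})$ (a local optimum for the respective neighborhood) satisfies $$f(\mathbf{x},\mathbf{y})\le\mathcal{A}(Q,C,D).$$
   Context: Bilinear assignment problem (BAP): let $m\le n$ be positive integers, $M=\{1,\dots,m\}$, $N=\{1,\dots,n\}$. An instance $(Q,C,D)$ consists of a real $m\times m\times n\times n$ array $Q=(q_{ijkl})$, a real $m\times m$ matrix $C=(c_{ij})$ and a real $n\times n$ matrix $D=(d_{kl})$. Let $\mathcal{X}$ (resp. $\mathcal{Y}$) be the set of $m\times m$ (resp. $n\times n$) permutation matrices. The feasible set is $\mathcal{F}=\mathcal{X}\times\mathcal{Y}$, and the objective, to be minimized, is $$f(\mathbf{x},\mathbf{y})=\sum_{i,j\in M}\sum_{k,l\in N} q_{ijkl}x_{ij}y_{kl}+\sum_{i,j\in M}c_{ij}x_{ij}+\sum_{k,l\in N}d_{kl}y_{kl}.$$ $\mathcal{A}(Q,C,D)$ is the arithmetic mean of $f$ over $\mathcal{F}$. Shifts: for $\mathbf{x}\in\mathcal{X}$ and $a\in M$, the shift $\mathbf{x}^{(a)}\in\mathcal{X}$ is given by $x^{(a)}_{ij}=x_{i,\,(j+a \bmod m)}$, where the residue $0$ is read as index $m$; for $\mathbf{y}\in\mathcal{Y}$ and $b\in N$, $\mathbf{y}^{(b)}\in\mathcal{Y}$ is given by $y^{(b)}_{kl}=y_{k,\,(l+b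 \bmod n)}$, where the residue $0$ is read as index $n$. The dual shift neighborhood of $(\mathbf{x},\mathbf{y})$ is $\{(\mathbf{x}^{(a)},\mathbf{y}^{(b)}): a\in M,\ b\in N\}$. The optimized shift neighborhood of $(\mathbf{x},\mathbf{y})$ is $\{(\mathbf{x}^{(a)},\mathbf{y}'): a\in M,\ \mathbf{y}'\in\mathcal{Y}\}\cup\{(\mathbf{x}',\mathbf{y}^{(b)}): \mathbf{x}'\in\mathcal{X},\ b\in N\}$. Local search based on a neighborhood moves repeatedly to a solution of the neighborhood with strictly smaller objective value until none exists; the final solution is then a local optimum. -}

module Defs where

open import Algebra.Apartness.Bundles using (HeytingCommutativeRing; HeytingField)
open import Algebra.Bundles using (CommutativeRing)
import Algebra.Apartness.Properties.HeytingCommutativeRing as HeytingProperties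
import Algebra.Definitions.RawMonoid as RawMonoidDefinitions
import Algebra.Properties.Monoid.Sum as MonoidSum
import Algebra.Properties.Ring as RingProperties
open import Data.Bool using (Bool; true; false; if_then_else_)
import Data.Bool.Properties as Bool
open import Data.Fin using (Fin; toℕ)
import Data.Fin.Properties as Fin
open import Data.List
  using (List; []; _∷_; [_]; foldr; map; filter; length; cartesianProduct; cartesianProductWith)
open import Data.List.Membership.Propositional using (_∈_)
open import Data.List.Membership.Propositional.Properties
  using (∈-filter⁺; ∈-cartesianProduct⁺; ∈-cartesianProductWith⁺; ∈-length)
open import Data.List.Relation.Unary.Any using (here; there)
open import Data.Nat using (ℕ; zero; suc; NonZero; >-nonZero)
import Data.Nat as ℕ
open import Data.Nat.DivMod using (_mod_)
open import Data.Product using (∃!; ∃-syntax; _×_; _,_; proj₁; proj₂)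
open import Data.Sum using (_⊎_; inj₁; inj₂)
open import Data.Vec using (Vec; []; _∷_; lookup; tabulate)
open import Data.Vec.Properties using (lookup∘tabulate)
open import Level using (Level; _⊔_) renaming (suc to lsuc)
open import Relation.Binary.Construct.Closure.ReflexiveTransitive using (Star)
open import Relation.Binary.Core using (Rel)
open import Relation.Binary.PropositionalEquality using (_≡_; refl; trans; sym)
open import Relation.Binary.Structures using (IsStrictPartialOrder)
open import Relation.Nullary using (¬_; Dec; does; yes; no)
open import Relation.Nullary.Decidable using (map′; _×-dec_; _→-dec_; dec-true)
open import Relation.Unary using (Pred)

-- ℝ enters only through the axioms of an ordered field.  They hold for ℝ read
-- classically (with x # y as ¬ x ≈ y) or constructively: neither decidability
-- nor totality of the order is required, and x ≤ y is ¬ y < x in both readings.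

record OrderedField (c ℓ₁ ℓ₂ ℓ₃ : Level) : Set (lsuc (c ⊔ ℓ₁ ⊔ ℓ₂ ⊔ ℓ₃)) where
  infix 4 _<_ _≤_
  field
    heytingField : HeytingField c ℓ₁ ℓ₂
  open HeytingField heytingField public
  field
    _<_                  : Rel Carrier ℓ₃
    isStrictPartialOrder : IsStrictPartialOrder _≈_ _<_
    <⇒#                  : ∀ {x y} → x < y → x # y
    #⇒<⊎>                : ∀ {x y} → x # y → x < y ⊎ y < x
    +-monoʳ-<            : ∀ x {y z} → y < z → x + y < x + z
    *-pos                : ∀ {x y} → 0# < x → 0# < y → 0# < x * y

  open IsStrictPartialOrder isStrictPartialOrder public
    using (<-resp-≈; <-respˡ-≈; <-respʳ-≈)
    renaming (irrefl to <-irrefl; trans to <-trans; asym to <-asym)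

  _≤_ : Rel Carrier ℓ₃
  x ≤ y = ¬ (y < x)

  commutativeRing : CommutativeRing c ℓ₁
  commutativeRing = HeytingCommutativeRing.commutativeRing heytingCommutativeRing

  open CommutativeRing commutativeRing public using (ring; +-monoid; +-rawMonoid)

  fromℕ : ℕ → Carrier
  fromℕ n = n ·ℕ 1#
    where open RawMonoidDefinitions +-rawMonoid using () renaming (_×_ to _·ℕ_)

  private
    module ≈ = CommutativeRing commutativeRing
    open RingProperties ring using (-1*x≈-x; -‿involutive)
    open HeytingProperties heytingCommutativeRing using (1#0)

  0<1 : 0# < 1#
  0<1 with #⇒<⊎> 1#0
  ... | inj₂ 0<1 = 0<1
  ... | inj₁ 1<0 = <-respʳ-≈ (≈.trans (-1*x≈-x (- 1#)) (-‿involutive 1#)) (*-pos 0<-1 0<-1)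
    where
    0<-1 : 0# < - 1#
    0<-1 = <-respˡ-≈ (≈.-‿inverseˡ 1#) (<-respʳ-≈ (≈.+-identityʳ (- 1#)) (+-monoʳ-< (- 1#) 1<0))

  0<fromℕ : ∀ n → 0# < fromℕ (suc n)
  0<fromℕ zero    = <-respʳ-≈ (≈.sym (≈.+-identityʳ 1#)) 0<1
  0<fromℕ (suc n) = <-trans 0<1 (<-respˡ-≈ (≈.+-identityʳ 1#) (+-monoʳ-< 1# (0<fromℕ n)))

  fromℕ#0 : ∀ n .{{_ : NonZero n}} → fromℕ n # 0#
  fromℕ#0 (suc n) = #-sym (<⇒# (0<fromℕ n))

  infixl 7 _/ℕ_

  -- #⇒invertible yields the inverse of fromℕ n - 0#.
  _/ℕ_ : Carrier → (n : ℕ) .{{_ : NonZero n}} → Carrier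
  x /ℕ n = x * proj₁ (#⇒invertible (fromℕ#0 n))

  mean : ∀ {a} {A : Set a} → (A → Carrier) → (xs : List A) .{{_ : NonZero (length xs)}} → Carrier
  mean f xs = foldr _+_ 0# (map f xs) /ℕ length xs

-- Square 0-1 matrices, true standing for 1.  Vectors rather than functions, so
-- that propositional equality is equality of matrices and they can be listed.

Matrix : ℕ → Set
Matrix m = Vec (Vec Bool m) m

entry : ∀ {m} → Matrix m → Fin m → Fin m → Bool
entry x i j = lookup (lookup x i) j

IsPermutationMatrix : ∀ {m} → Matrix m → Set
IsPermutationMatrix x =
  (∀ i → ∃! _≡_ λ j → entry x i j ≡ true) × (∀ j → ∃! _≡_ λ i → entry x i j ≡ true)

∃!? : ∀ {m} (p : Fin m → Bool) → Dec (∃! _≡_ λ j → p j ≡ true)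
∃!? p = map′ (λ (j , pj , uniq) → j , pj , λ {k} → uniq k)
             (λ (j , pj , uniq) → j , pj , λ k → uniq {k})
             (Fin.any? λ j → (p j Bool.≟ true) ×-dec
                             Fin.all? λ k → (p k Bool.≟ true) →-dec (j Fin.≟ k))

isPermutationMatrix? : ∀ {m} (x : Matrix m) → Dec (IsPermutationMatrix x)
isPermutationMatrix? x = Fin.all? (λ i → ∃!? (entry x i)) ×-dec
                         Fin.all? (λ j → ∃!? (λ i → entry x i j))

vectors : ∀ {a} {A : Set a} → List A → ∀ n → List (Vec A n)
vectors xs zero    = [ [] ]
vectors xs (suc n) = cartesianProductWith _∷_ xs (vectors xs n)

permutationMatrices : ∀ m → List (Matrix m)
permutationMatrices m =
  filter isPermutationMatrix? (vectors (vectors (true ∷ false ∷ []) m) m)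

Solution : ℕ → ℕ → Set
Solution m n = Matrix m × Matrix n

Feasible : ∀ {m n} → Solution m n → Set
Feasible (x , y) = IsPermutationMatrix x × IsPermutationMatrix y

feasibleSolutions : ∀ m n → List (Solution m n)
feasibleSolutions m n = cartesianProduct (permutationMatrices m) (permutationMatrices n)

∈-vectors : ∀ {a} {A : Set a} {xs : List A} → (∀ x → x ∈ xs) →
            ∀ {n} (v : Vec A n) → v ∈ vectors xs n
∈-vectors all∈ []      = here refl
∈-vectors all∈ (x ∷ v) = ∈-cartesianProductWith⁺ _∷_ (all∈ x) (∈-vectors all∈ v)

∈-permutationMatrices : ∀ {m} {x : Matrix m} → IsPermutationMatrix x → x ∈ permutationMatrices m
∈-permutationMatrices {x = x} = ∈-filter⁺ isPermutationMatrix? (∈-vectors (∈-vectors λ where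
  true  → here refl
  false → there (here refl)) x)

∈-feasibleSolutions : ∀ {m n} {s : Solution m n} → Feasible s → s ∈ feasibleSolutions m n
∈-feasibleSolutions (px , py) =
  ∈-cartesianProduct⁺ (∈-permutationMatrices px) (∈-permutationMatrices py)

identity : ∀ m → Matrix m
identity m = tabulate λ i → tabulate λ j → does (i Fin.≟ j)

entry-identity : ∀ {m} (i j : Fin m) → entry (identity m) i j ≡ does (i Fin.≟ j)
entry-identity {m} i j
  rewrite lookup∘tabulate (λ i → tabulate λ j → does (i Fin.≟ j)) i = lookup∘tabulate _ j

identity-diagonal : ∀ {m} (i : Fin m) → entry (identity m) i i ≡ true
identity-diagonal i = trans (entry-identity i i) (dec-true (i Fin.≟ i) refl)

identity-true⇒≡ : ∀ {m} (i j : Fin m) → entry (identity m) i j ≡ true → i ≡ j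
identity-true⇒≡ i j e with i Fin.≟ j | trans (sym (entry-identity i j)) e
... | yes i≡j | _ = i≡j

identity-isPermutationMatrix : ∀ m → IsPermutationMatrix (identity m)
identity-isPermutationMatrix m =
    (λ i → i , identity-diagonal i , λ {j} e → identity-true⇒≡ i j e)
  , (λ j → j , identity-diagonal j , λ {i} e → sym (identity-true⇒≡ i j e))

feasibleSolutions-nonZero : ∀ m n → NonZero (length (feasibleSolutions m n))
feasibleSolutions-nonZero m n = >-nonZero (∈-length (∈-feasibleSolutions
  {s = identity m , identity n}
  (identity-isPermutationMatrix m , identity-isPermutationMatrix n)))

-- The residue 0 read as index m, for indices counted from 1, is ordinary
-- reduction mod m for indices counted from 0.
shift : ∀ {m} .{{_ : NonZero m}} → ℕ → Matrix m → Matrix m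
shift {m} a x = tabulate λ i → tabulate λ j → entry x i ((toℕ j ℕ.+ a) mod m)

-- The element of {1, …, m} that the index i stands for.
index : ∀ {m} → Fin m → ℕ
index i = suc (toℕ i)

Neighborhood : ℕ → ℕ → Set₁
Neighborhood m n = Solution m n → Pred (Solution m n) Level.zero

module _ {m n : ℕ} .{{_ : NonZero m}} .{{_ : NonZero n}} where

  dualShift : Neighborhood m n
  dualShift (x , y) t =
    ∃[ a ] ∃[ b ] t ≡ (shift (index {m} a) x , shift (index {n} b) y)

  optimizedShift : Neighborhood m n
  optimizedShift (x , y) t =
      (∃[ a ] ∃[ y′ ] IsPermutationMatrix y′ × t ≡ (shift (index {m} a) x , y′))
    ⊎ (∃[ x′ ] ∃[ b ] IsPermutationMatrix x′ × t ≡ (x′ , shift (index {n} b) y))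

module BAP {c ℓ₁ ℓ₂ ℓ₃ : Level} (K : OrderedField c ℓ₁ ℓ₂ ℓ₃) where
  open OrderedField K hiding (_≤_)
  open OrderedField K public using (_≤_)
  open MonoidSum +-monoid using (sum-syntax)

  record Instance (m n : ℕ) : Set c where
    field
      Q : Fin m → Fin m → Fin n → Fin n → Carrier
      C : Fin m → Fin m → Carrier
      D : Fin n → Fin n → Carrier

  ⟦_⟧ : Bool → Carrier
  ⟦ b ⟧ = if b then 1# else 0#

  module _ {m n : ℕ} (I : Instance m n) where
    open Instance I

    objective : Solution m n → Carrier
    objective (x , y) =
        (∑[ i < m ] ∑[ j < m ] ∑[ k < n ] ∑[ l < n ]
          (Q i j k l * ⟦ entry x i j ⟧ * ⟦ entry y k l ⟧))
      + (∑[ i < m ] ∑[ j < m ] (C i j * ⟦ entry x i j ⟧))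
      + (∑[ k < n ] ∑[ l < n ] (D k l * ⟦ entry y k l ⟧))

    average : Carrier
    average = mean objective (feasibleSolutions m n) {{feasibleSolutions-nonZero m n}}

    Improves : Neighborhood m n → Rel (Solution m n) ℓ₃
    Improves 𝒩 s t = 𝒩 s t × objective t < objective s

    LocalOptimum : Neighborhood m n → Pred (Solution m n) ℓ₃
    LocalOptimum 𝒩 s = ∀ t → ¬ Improves 𝒩 s t

    -- t is a possible final solution of local search started from s.
    LocalSearch : Neighborhood m n → Rel (Solution m n) ℓ₃
    LocalSearch 𝒩 s t = Star (Improves 𝒩) s t × LocalOptimum 𝒩 t

{-# OPTIONS --safe #-}
module Submission where

-- Over all m n pairs (a , b), the sum of f(x^(a), y^(b)) does not depend on the
-- feasible solution (x , y): each entry of x^(a) is 1 for exactly one a.  Since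
-- every pair of shifts permutes the feasible set, this sum is m n 𝒜(Q,C,D).
-- Were 𝒜 < f(x, y) at a local optimum, cotransitivity of < would give
-- 𝒜 < f(x^(a), y^(b)) for all (a , b), and summing would contradict this.
-- A local optimum for optimized shifts is one for dual shifts.

open import Defs
open import Data.Nat using (ℕ; NonZero) renaming (_≤_ to _≤ⁿ_)
open import Data.Product using (_×_)
open import Level using (Level)
open import Algebra.Bundles using (CommutativeRing)
import Algebra.Properties.Semiring.Sum as SemiringSum
import Algebra.Properties.Ring as RingProperties
open import Data.Bool using (Bool; true; false)
import Data.Bool.Properties as Bool
open import Data.Empty using (⊥-elim)
open import Data.Fin using (Fin; zero; suc; toℕ; punchIn)
import Data.Fin.Properties as Fin
open import Data.Fin.Permutation using (Permutation; permutation)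
open import Data.List using (List; []; _∷_; map; foldr; length)
open import Data.List.Membership.Propositional using (_∈_)
open import Data.List.Membership.Propositional.Properties
  using (∈-filter⁻; ∈-cartesianProduct⁻; ∈-map⁺; ∈-map⁻)
open import Data.List.Membership.Propositional.Properties.WithK using (unique∧set⇒bag)
open import Data.List.Properties using (map-∘)
open import Data.List.Relation.Binary.BagAndSetEquality using (∼bag⇒↭)
open import Data.List.Relation.Binary.Permutation.Propositional using (_↭_; ↭⇒↭ₛ′)
import Data.List.Relation.Binary.Permutation.Propositional.Properties as ↭
import Data.List.Relation.Binary.Permutation.Setoid.Properties as ↭ₛ
open import Data.List.Relation.Unary.All using ([]; _∷_)
open import Data.List.Relation.Unary.Any using (here; there)
open import Data.List.Relation.Unary.Unique.Propositional using (Unique)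
import Data.List.Relation.Unary.Unique.Propositional.Properties as Unique
import Data.List.Relation.Unary.AllPairs as AllPairs
import Data.Nat as ℕ
open import Data.Nat.DivMod
  using (_mod_; _%_; [m+n]%n≡m%n; m<n⇒m%n≡m; %-distribˡ-+; m%n%n≡m%n)
import Data.Nat.Properties as ℕ
open import Data.Product using (_,_; proj₁; proj₂)
open import Data.Sum using (_⊎_; inj₁; inj₂)
open import Data.Vec using (_∷_; lookup; tabulate)
open import Data.Vec.Properties using (lookup∘tabulate; tabulate∘lookup; tabulate-cong; ∷-injective)
open import Function using (_∘_; mk⇔)
open import Relation.Binary.Construct.Closure.ReflexiveTransitive using (Star; ε; _◅_)
open import Relation.Binary.PropositionalEquality as ≡ using (_≡_; cong; cong₂; subst; module ≡-Reasoning)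
import Relation.Binary.Reasoning.Setoid as ≈-Reasoning

-- Cyclic rotations of indices and shifts of permutation matrices.

rotate : ∀ {m} .{{_ : NonZero m}} → ℕ → Fin m → Fin m
rotate {m} c j = (toℕ j ℕ.+ c) mod m

-- Rotating back is expressed by a complementary amount, so no negation mod `m` is needed: the two
-- reductions merge and leave `toℕ j + m`.
rotate-inverse : ∀ {m} .{{_ : NonZero m}} {c d} → c ℕ.+ d ≡ m →
                 ∀ (j : Fin m) → rotate d (rotate c j) ≡ j
rotate-inverse {m} {c} {d} c+d≡m j = Fin.toℕ-injective (begin
  toℕ (rotate d (rotate c j))               ≡⟨ Fin.toℕ-fromℕ< _ ⟩
  (toℕ (rotate c j) ℕ.+ d) % m              ≡⟨ cong (λ k → (k ℕ.+ d) % m) (Fin.toℕ-fromℕ< _) ⟩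
  ((toℕ j ℕ.+ c) % m ℕ.+ d) % m             ≡⟨ %-distribˡ-+ ((toℕ j ℕ.+ c) % m) d m ⟩
  ((toℕ j ℕ.+ c) % m % m ℕ.+ d % m) % m     ≡⟨ cong (λ k → (k ℕ.+ d % m) % m) (m%n%n≡m%n (toℕ j ℕ.+ c) m) ⟩
  ((toℕ j ℕ.+ c) % m ℕ.+ d % m) % m         ≡⟨ %-distribˡ-+ (toℕ j ℕ.+ c) d m ⟨
  (toℕ j ℕ.+ c ℕ.+ d) % m                   ≡⟨ cong (_% m) (ℕ.+-assoc (toℕ j) c d) ⟩
  (toℕ j ℕ.+ (c ℕ.+ d)) % m                 ≡⟨ cong (λ k → (toℕ j ℕ.+ k) % m) c+d≡m ⟩
  (toℕ j ℕ.+ m) % m                         ≡⟨ [m+n]%n≡m%n (toℕ j) m ⟩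
  toℕ j % m                                 ≡⟨ m<n⇒m%n≡m (Fin.toℕ<n j) ⟩
  toℕ j                                     ∎)
  where open ≡-Reasoning

rotation : ∀ {m} .{{_ : NonZero m}} {c d} → c ℕ.+ d ≡ m → Permutation m m
rotation {c = c} {d} c+d≡m = permutation (rotate c) (rotate d)
  (rotate-inverse (≡.trans (ℕ.+-comm d c) c+d≡m)) (rotate-inverse c+d≡m)

-- For the last index the complement is 0, matching the shift by `m`, which is the identity.
index-complement : ∀ {m} (i : Fin m) → index i ℕ.+ (m ℕ.∸ index i) ≡ m
index-complement i = ℕ.m+[n∸m]≡n (Fin.toℕ<n i)

entry-shift : ∀ {m} .{{_ : NonZero m}} c (x : Matrix m) i j →
              entry (shift c x) i j ≡ entry x i (rotate c j)
entry-shift c x i j = ≡.trans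
  (cong (λ row → lookup row j) (lookup∘tabulate (λ i → tabulate λ j → entry x i (rotate c j)) i))
  (lookup∘tabulate (λ j → entry x i (rotate c j)) j)

shift-inverse : ∀ {m} .{{_ : NonZero m}} {c d} → c ℕ.+ d ≡ m →
                ∀ (x : Matrix m) → shift c (shift d x) ≡ x
shift-inverse {c = c} {d} c+d≡m x = ≡.trans
  (tabulate-cong λ i → ≡.trans
    (tabulate-cong λ j → ≡.trans (entry-shift d x i (rotate c j))
                                 (cong (entry x i) (rotate-inverse c+d≡m j)))
    (tabulate∘lookup (lookup x i)))
  (tabulate∘lookup x)

-- In row `i` the unique 1 moves from column `j` to `rotate d j`, while column `j` of the shift is
-- column `rotate c j` of `x`.
shift-isPermutationMatrix : ∀ {m} .{{_ : NonZero m}} {c d} → c ℕ.+ d ≡ m →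
  ∀ (x : Matrix m) → IsPermutationMatrix x → IsPermutationMatrix (shift c x)
shift-isPermutationMatrix {c = c} {d} c+d≡m x (rows , columns) = rows′ , columns′
  where
  d+c≡m = ≡.trans (ℕ.+-comm d c) c+d≡m
  rows′ : ∀ i → _
  rows′ i with j , xij , uniq ← rows i
    = rotate d j
    , ≡.trans (entry-shift c x i (rotate d j))
        (≡.trans (cong (entry x i) (rotate-inverse d+c≡m j)) xij)
    , λ {k} e → ≡.trans (cong (rotate d) (uniq (≡.trans (≡.sym (entry-shift c x i k)) e)))
                        (rotate-inverse c+d≡m k)
  columns′ : ∀ j → _
  columns′ j with i , xij , uniq ← columns (rotate c j)
    = i
    , ≡.trans (entry-shift c x i j) xij
    , λ {k} e → uniq (≡.trans (≡.sym (entry-shift c x k j)) e)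

-- The list of feasible solutions and its invariance under shifts.

vectors-unique : ∀ {a} {A : Set a} {xs : List A} → Unique xs → ∀ n → Unique (vectors xs n)
vectors-unique xs! ℕ.zero    = [] AllPairs.∷ AllPairs.[]
vectors-unique xs! (ℕ.suc n) =
  Unique.cartesianProductWith⁺ _∷_ ∷-injective xs! (vectors-unique xs! n)

feasibleSolutions-unique : ∀ m n → Unique (feasibleSolutions m n)
feasibleSolutions-unique m n =
  Unique.cartesianProduct⁺ (permutationMatrices-unique m) (permutationMatrices-unique n)
  where
  permutationMatrices-unique : ∀ m → Unique (permutationMatrices m)
  permutationMatrices-unique m = Unique.filter⁺ isPermutationMatrix?
    (vectors-unique (vectors-unique
      (((λ ()) ∷ []) AllPairs.∷ [] AllPairs.∷ AllPairs.[]) m) m)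

∈-feasibleSolutions⁻ : ∀ {m n} (s : Solution m n) → s ∈ feasibleSolutions m n → Feasible s
∈-feasibleSolutions⁻ {m} {n} _ s∈ =
  let x∈ , y∈ = ∈-cartesianProduct⁻ (permutationMatrices m) (permutationMatrices n) s∈ in
  proj₂ (∈-filter⁻ isPermutationMatrix? {xs = vectors (vectors (true ∷ false ∷ []) m) m} x∈) ,
  proj₂ (∈-filter⁻ isPermutationMatrix? {xs = vectors (vectors (true ∷ false ∷ []) n) n} y∈)

-- Duplicate-free lists with the same members are permutations of each other. The left inverse keeps
-- `map f xs` duplicate-free; the right inverse shows that every member is hit.
map-↭ : ∀ {a} {A : Set a} {xs : List A} → Unique xs → (f g : A → A) →
        (∀ x → g (f x) ≡ x) → (∀ x → f (g x) ≡ x) →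
        (∀ {x} → x ∈ xs → f x ∈ xs) → (∀ {x} → x ∈ xs → g x ∈ xs) → map f xs ↭ xs
map-↭ {xs = xs} xs! f g gf fg f∈ g∈ = ∼bag⇒↭ (unique∧set⇒bag
  (Unique.map⁺ (λ {x} {y} e → ≡.trans (≡.sym (gf x)) (≡.trans (cong g e) (gf y))) xs!) xs!
  (mk⇔ (λ y∈ → let x , x∈ , y≡fx = ∈-map⁻ f y∈ in subst (_∈ xs) (≡.sym y≡fx) (f∈ x∈))
       (λ {y∈ → subst (_∈ map f xs) (fg _) (∈-map⁺ f (g∈ y∈))})))

module _ {m n : ℕ} .{{_ : NonZero m}} .{{_ : NonZero n}} where

  shifted : Solution m n → Fin m → Fin n → Solution m n
  shifted (x , y) a b = shift (index a) x , shift (index b) y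

  shifted-feasible : ∀ s → Feasible s → ∀ a b → Feasible (shifted s a b)
  shifted-feasible (x , y) (px , py) a b =
    shift-isPermutationMatrix (index-complement a) x px ,
    shift-isPermutationMatrix (index-complement b) y py

  -- This allows the average to be reindexed by any pair of shifts; the inverse shifts by the
  -- complements of `index a` and `index b`.
  shifted-↭ : ∀ a b → map (λ s → shifted s a b) (feasibleSolutions m n) ↭ feasibleSolutions m n
  shifted-↭ a b = map-↭ (feasibleSolutions-unique m n)
    (λ s → shifted s a b)
    (λ (x , y) → shift (m ℕ.∸ index a) x , shift (n ℕ.∸ index b) y)
    (λ (x , y) → cong₂ _,_ (shift-inverse (complement a) x) (shift-inverse (complement b) y))
    (λ (x , y) → cong₂ _,_ (shift-inverse (index-complement a) x)
                           (shift-inverse (index-complement b) y))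
    (λ {s} s∈ → ∈-feasibleSolutions {s = shifted s a b}
      (shifted-feasible s (∈-feasibleSolutions⁻ s s∈) a b))
    (λ {s@(x , y)} s∈ → let px , py = ∈-feasibleSolutions⁻ s s∈ in
      ∈-feasibleSolutions {s = shift (m ℕ.∸ index a) x , shift (n ℕ.∸ index b) y}
        ( shift-isPermutationMatrix (complement a) x px
        , shift-isPermutationMatrix (complement b) y py))
    where
    complement : ∀ {m} (i : Fin m) → m ℕ.∸ index i ℕ.+ index i ≡ m
    complement i = ℕ.m∸n+n≡m (Fin.toℕ<n i)

  dualShift-feasible : ∀ s t → dualShift {m} {n} s t → Feasible s → Feasible t
  dualShift-feasible s _ (a , b , ≡.refl) ps = shifted-feasible s ps a b

  optimizedShift-feasible : ∀ s t → optimizedShift {m} {n} s t → Feasible s → Feasible t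
  optimizedShift-feasible (x , _) _ (inj₁ (a , y , py , ≡.refl)) (px , _) =
    shift-isPermutationMatrix (index-complement a) x px , py
  optimizedShift-feasible (_ , y) _ (inj₂ (x , b , px , ≡.refl)) (_ , py) =
    px , shift-isPermutationMatrix (index-complement b) y py

-- Strict inequalities, sums and means in an ordered field.

module Averaging {c ℓ₁ ℓ₂ ℓ₃ : Level} (K : OrderedField c ℓ₁ ℓ₂ ℓ₃) where
  open OrderedField K hiding (zero)
  open BAP K hiding (_≤_)
  open CommutativeRing commutativeRing using (semiring)
  open SemiringSum semiring
  open RingProperties ring using (-0#≈0#)
  open ≈-Reasoning setoid

  -- Inherited from cotransitivity of apartness; it replaces a case distinction on an order that
  -- need not be decidable.
  <-cotrans : ∀ {x z} → x < z → ∀ y → x < y ⊎ y < z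
  <-cotrans x<z y with #-cotrans (<⇒# x<z) y
  ... | inj₁ x#y with #⇒<⊎> x#y
  ...   | inj₁ x<y = inj₁ x<y
  ...   | inj₂ y<x = inj₂ (<-trans y<x x<z)
  <-cotrans x<z y | inj₂ y#z with #⇒<⊎> y#z
  ...   | inj₁ y<z = inj₂ y<z
  ...   | inj₂ z<y = inj₁ (<-trans x<z z<y)

  +-mono-< : ∀ {x y u v} → x < y → u < v → x + u < y + v
  +-mono-< {x} {y} {u} {v} x<y u<v = <-trans (+-monoʳ-< x u<v)
    (<-respˡ-≈ (+-comm v x) (<-respʳ-≈ (+-comm v y) (+-monoʳ-< v x<y)))

  sum-mono-< : ∀ {n} .{{_ : NonZero n}} {f g : Fin n → Carrier} →
               (∀ i → f i < g i) → sum f < sum g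
  -- The induction starts at one summand, since empty sums are never strictly ordered.
  sum-mono-< {ℕ.suc ℕ.zero} f<g =
    <-respˡ-≈ (sym (+-identityʳ _)) (<-respʳ-≈ (sym (+-identityʳ _)) (f<g zero))
  sum-mono-< {ℕ.suc (ℕ.suc n)} f<g = +-mono-< (f<g zero) (sum-mono-< (f<g ∘ suc))

  module _ {a} {A : Set a} where

    sumᴸ : (A → Carrier) → List A → Carrier
    sumᴸ f xs = foldr _+_ 0# (map f xs)

    sumᴸ-∑-comm : ∀ {p} (g : Fin p → A → Carrier) xs →
                  ∑[ i < p ] sumᴸ (g i) xs ≈ sumᴸ (λ x → ∑[ i < p ] g i x) xs
    sumᴸ-∑-comm {p} g []       = sum-replicate-zero p
    sumᴸ-∑-comm {p} g (x ∷ xs) =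
      trans (∑-distrib-+ (λ i → g i x) (λ i → sumᴸ (g i) xs)) (+-congˡ (sumᴸ-∑-comm g xs))

    sumᴸ-const : ∀ {g : A → Carrier} {u} xs → (∀ {x} → x ∈ xs → g x ≈ u) →
                 sumᴸ g xs ≈ u * fromℕ (length xs)
    sumᴸ-const         []       g≈u = sym (zeroʳ _)
    sumᴸ-const {g} {u} (x ∷ xs) g≈u = begin
      g x + sumᴸ g xs               ≈⟨ +-cong (g≈u (here ≡.refl)) (sumᴸ-const xs (g≈u ∘ there)) ⟩
      u + u * fromℕ (length xs)      ≈⟨ +-congʳ (*-identityʳ u) ⟨
      u * 1# + u * fromℕ (length xs) ≈⟨ distribˡ u 1# _ ⟨
      u * (1# + fromℕ (length xs))   ∎

    mean-∑-comm : ∀ {p} (g : Fin p → A → Carrier) xs .{{_ : NonZero (length xs)}} →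
                  ∑[ i < p ] mean (g i) xs ≈ mean (λ x → ∑[ i < p ] g i x) xs
    mean-∑-comm g xs = trans (sym (*-distribʳ-sum _ (λ i → sumᴸ (g i) xs)))
                             (*-congʳ (sumᴸ-∑-comm g xs))

    -- Constancy is asked only on members of `xs`, because `shiftSum` is controlled only at feasible
    -- solutions.
    mean-const : ∀ {g : A → Carrier} {u} xs .{{_ : NonZero (length xs)}} →
                 (∀ {x} → x ∈ xs → g x ≈ u) → mean g xs ≈ u
    mean-const {g} {u} xs g≈u = begin
      sumᴸ g xs * inv              ≈⟨ *-congʳ (sumᴸ-const xs g≈u) ⟩
      u * k * inv                  ≈⟨ *-assoc u k inv ⟩
      -- `inv` is given as an inverse of `k - 0#`, so `k` is rewritten to that form.
      u * (k * inv)                ≈⟨ *-congˡ (*-congʳ (trans (+-congˡ -0#≈0#) (+-identityʳ k))) ⟨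
      u * ((k - 0#) * inv)         ≈⟨ *-congˡ (proj₂ (proj₂ (#⇒invertible (fromℕ#0 (length xs))))) ⟩
      u * 1#                       ≈⟨ *-identityʳ u ⟩
      u                            ∎
      where
      k   = fromℕ (length xs)
      inv = proj₁ (#⇒invertible (fromℕ#0 (length xs)))

    mean-↭ : ∀ (g : A → Carrier) (f : A → A) xs .{{_ : NonZero (length xs)}} →
             map f xs ↭ xs → mean (g ∘ f) xs ≈ mean g xs
    mean-↭ g f xs fxs↭xs = *-congʳ (trans
      (reflexive (cong (foldr _+_ 0#) (map-∘ xs)))
      (↭ₛ.foldr-commMonoid setoid +-isCommutativeMonoid
        (↭⇒↭ₛ′ isEquivalence (↭.map⁺ g fxs↭xs))))

  -- Once the term at `i` is split off, the remaining indices `punchIn i k` differ from `i`, so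
  -- uniqueness makes their terms vanish.
  ∑-indicator : ∀ {m} (p : Fin m → Bool) i → p i ≡ true → (∀ {k} → p k ≡ true → i ≡ k) →
                ∑[ k < m ] ⟦ p k ⟧ ≈ 1#
  ∑-indicator {ℕ.suc m} p i pi uniq = begin
    sum (λ k → ⟦ p k ⟧)                           ≈⟨ sum-remove {i = i} (λ k → ⟦ p k ⟧) ⟩
    ⟦ p i ⟧ + ∑[ k < m ] ⟦ p (punchIn i k) ⟧      ≈⟨ +-cong (reflexive (cong ⟦_⟧ pi))
                                                      (sum-cong-≋ λ k → reflexive (cong ⟦_⟧ (others k))) ⟩
    1# + ∑[ k < m ] 0#                            ≈⟨ +-congˡ (sum-replicate-zero m) ⟩
    1# + 0#                                       ≈⟨ +-identityʳ 1# ⟩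
    1#                                            ∎
    where
    others : ∀ k → p (punchIn i k) ≡ false
    others k = Bool.¬-not (Fin.punchInᵢ≢i i k ∘ ≡.sym ∘ uniq)

  -- As a runs through M, column j of x^(a) runs through all columns of x.
  ∑-shift-entry : ∀ {m} .{{_ : NonZero m}} (x : Matrix m) → IsPermutationMatrix x → ∀ i j →
                  ∑[ a < m ] ⟦ entry (shift (index a) x) i j ⟧ ≈ 1#
  ∑-shift-entry {m} x (rows , _) i j = begin
    ∑[ a < m ] ⟦ entry (shift (index a) x) i j ⟧  ≡⟨ sum-cong-≗ (λ a → cong ⟦_⟧ (≡.trans
                                                       (entry-shift (index a) x i j) (cong (entry x i) (swap a)))) ⟩
    ∑[ a < m ] ⟦ entry x i (rotate (index j) a) ⟧ ≈⟨ ∑-permute (λ k → ⟦ entry x i k ⟧) (rotation (index-complement j)) ⟨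
    ∑[ k < m ] ⟦ entry x i k ⟧                    ≈⟨ (let k , xik , uniq = rows i in ∑-indicator (entry x i) k xik uniq) ⟩
    1#                                            ∎
    where
    -- As j + (a + 1) = a + (j + 1), the column read is `a` rotated by `index j`: a permutation in
    -- the summation variable.
    swap : ∀ a → rotate (index a) j ≡ rotate (index j) a
    swap a = cong (_mod m) (≡.trans (ℕ.+-comm (toℕ j) (index a)) (≡.sym (ℕ.+-suc (toℕ a) (toℕ j))))

  ∑-weighted : ∀ p q {t : Fin p → Carrier} → sum t ≈ 1# → ∑[ i < p ] (q * t i) ≈ q
  ∑-weighted _ q {t} Σt≈1 =
    trans (sym (*-distribˡ-sum q t)) (trans (*-congˡ Σt≈1) (*-identityʳ q))

  -- Double sums over pairs of shifts.

  module DoubleSum (m n : ℕ) where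

    ∑∑ : (Fin m → Fin n → Carrier) → Carrier
    ∑∑ g = ∑[ a < m ] ∑[ b < n ] g a b

    ∑∑-cong : ∀ {g h : Fin m → Fin n → Carrier} → (∀ a b → g a b ≈ h a b) → ∑∑ g ≈ ∑∑ h
    ∑∑-cong g≈h = sum-cong-≋ λ a → sum-cong-≋ (g≈h a)

    ∑∑-distrib-+ : ∀ (g h : Fin m → Fin n → Carrier) → ∑∑ (λ a b → g a b + h a b) ≈ ∑∑ g + ∑∑ h
    ∑∑-distrib-+ g h = trans (sum-cong-≋ λ a → ∑-distrib-+ (g a) (h a)) (∑-distrib-+ (sum ∘ g) (sum ∘ h))

    -- Each use moves the sum over shifts past one index sum of the objective, until a single
    -- coefficient remains.
    ∑∑-∑ : ∀ p {g : Fin p → Fin m → Fin n → Carrier} {h : Fin p → Carrier} →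
           (∀ i → ∑∑ (g i) ≈ h i) → ∑∑ (λ a b → ∑[ i < p ] g i a b) ≈ ∑[ i < p ] h i
    ∑∑-∑ _ {g} g≈h = trans (sum-cong-≋ λ a → ∑-comm (λ b i → g i a b))
      (trans (∑-comm (λ a i → sum (g i a))) (sum-cong-≋ g≈h))

  -- The sum over all shifts and the bound at local optima.

  module _ {m n : ℕ} .{{_ : NonZero m}} .{{_ : NonZero n}} (I : Instance m n) where
    open Instance I
    open DoubleSum m n

    shiftSum : Solution m n → Carrier
    shiftSum s = ∑∑ λ a b → objective I (shifted s a b)

    -- Each `Q i j k l` is selected by exactly one pair of shifts, each `C i j` by one `a` with
    -- every `b`, each `D k l` by one `b` with every `a`; the innermost constant sums record these
    -- multiplicities.
    total : Carrier
    total = (∑[ i < m ] ∑[ j < m ] ∑[ k < n ] ∑[ l < n ] Q i j k l)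
          + (∑[ i < m ] ∑[ j < m ] ∑[ b < n ] C i j)
          + (∑[ k < n ] ∑[ l < n ] ∑[ a < m ] D k l)

    shiftSum≈total : ∀ s → Feasible s → shiftSum s ≈ total
    shiftSum≈total (x , y) (px , py) = trans (∑∑-distrib-+ _ _) (+-cong
      (trans (∑∑-distrib-+ _ _) (+-cong
        (∑∑-∑ m λ i → ∑∑-∑ m λ j → ∑∑-∑ n λ k → ∑∑-∑ n λ l → trans
          -- For fixed `a` the entry of the shifted `x` belongs to the weight, so the sum over `b`
          -- collapses first and the sum over `a` next.
          (sum-cong-≋ {m} λ a → ∑-weighted n (Q i j k l * ⟦ entry (shift (index a) x) i j ⟧)
                                           (∑-shift-entry y py k l))
          (∑-weighted m (Q i j k l) (∑-shift-entry x px i j)))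
        (∑∑-∑ m λ i → ∑∑-∑ m λ j → trans
          -- The term is constant in `b`; swapping makes the sum over `a` the inner one, where it
          -- collapses to `C i j`.
          (∑-comm {m} {n} λ a _ → C i j * ⟦ entry (shift (index a) x) i j ⟧)
          (sum-cong-≋ {n} λ b → ∑-weighted m (C i j) (∑-shift-entry x px i j)))))
      (∑∑-∑ n λ k → ∑∑-∑ n λ l → sum-cong-≋ {m} λ a →
        ∑-weighted n (D k l) (∑-shift-entry y py k l)))

    -- Double counting over shift pairs and feasible solutions: for a fixed pair the mean is
    -- `average I`, and for a fixed solution the sum over pairs is `total`.
    ∑∑-average : ∑∑ (λ a b → average I) ≈ total
    ∑∑-average = begin
      ∑∑ (λ a b → average I)
        ≈⟨ ∑∑-cong (λ a b → mean-↭ (objective I) (λ s → shifted s a b) 𝓕 (shifted-↭ a b)) ⟨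
      ∑∑ (λ a b → mean (λ s → objective I (shifted s a b)) 𝓕)
        ≈⟨ sum-cong-≋ (λ a → mean-∑-comm (λ b s → objective I (shifted s a b)) 𝓕) ⟩
      ∑[ a < m ] mean (λ s → ∑[ b < n ] objective I (shifted s a b)) 𝓕
        ≈⟨ mean-∑-comm (λ a s → ∑[ b < n ] objective I (shifted s a b)) 𝓕 ⟩
      mean shiftSum 𝓕
        ≈⟨ mean-const 𝓕 (λ {s} → shiftSum≈total s ∘ ∈-feasibleSolutions⁻ s) ⟩
      total ∎
      where
      𝓕 = feasibleSolutions m n
      instance
        𝓕-nonZero : NonZero (length 𝓕)
        𝓕-nonZero = feasibleSolutions-nonZero m n

    dualShift-optimum≤average : ∀ s → Feasible s → LocalOptimum I dualShift s →
                                objective I s ≤ average I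
    dualShift-optimum≤average s ps opt avg<fs = <-irrefl
      (trans ∑∑-average (sym (shiftSum≈total s ps)))
      (sum-mono-< λ a → sum-mono-< λ b → avg<shifted a b)
      where
      avg<shifted : ∀ a b → average I < objective I (shifted s a b)
      -- The other alternative would make the shifted solution a strict improvement on `s`.
      avg<shifted a b with <-cotrans avg<fs (objective I (shifted s a b))
      ... | inj₁ avg<t = avg<t
      ... | inj₂ t<fs  = ⊥-elim (opt (shifted s a b) ((a , b , ≡.refl) , t<fs))

    -- A shift of the permutation matrix `y` is itself an admissible `y′`, so dual shift neighbors
    -- are optimized shift neighbors.
    optimizedShift⇒dualShift-optimum : ∀ s → Feasible s → LocalOptimum I optimizedShift s →
                                       LocalOptimum I dualShift s
    optimizedShift⇒dualShift-optimum (_ , y) (_ , py) opt t ((a , b , t≡) , t<s) =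
      opt t (inj₁ (a , _ , shift-isPermutationMatrix (index-complement b) y py , t≡) , t<s)

    -- The bound needs a feasible final solution, whereas feasibility is given only at the start; it
    -- is carried along the moves.
    Star-feasible : ∀ {𝒩 : Neighborhood m n} → (∀ s t → 𝒩 s t → Feasible s → Feasible t) →
                    ∀ {s t} → Star (Improves I 𝒩) s t → Feasible s → Feasible t
    Star-feasible 𝒩-feasible ε                  ps = ps
    Star-feasible 𝒩-feasible {s} (_◅_ {j = t} (st , _) moves) ps =
      Star-feasible 𝒩-feasible moves (𝒩-feasible s t st ps)

theorem12 : ∀ {c ℓ₁ ℓ₂ ℓ₃ : Level} (K : OrderedField c ℓ₁ ℓ₂ ℓ₃) → let open BAP K in
    {m n : ℕ} .{{_ : NonZero m}} .{{_ : NonZero n}} → m ≤ⁿ n →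
    (I : Instance m n) (start final : Solution m n) → Feasible start →
    (LocalSearch I dualShift start final → objective I final ≤ average I) ×
    (LocalSearch I optimizedShift start final → objective I final ≤ average I)
theorem12 K _ I _ final feasible =
    (λ (moves , opt) →
      dualShift-optimum≤average I final
        (Star-feasible I {dualShift} dualShift-feasible moves feasible) opt)
  , (λ (moves , opt) →
      let final-feasible = Star-feasible I {optimizedShift} optimizedShift-feasible moves feasible in
      dualShift-optimum≤average I final final-feasible
        (optimizedShift⇒dualShift-optimum I final final-feasible opt))
  where open Averaging K
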